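{- Let $\delta$ be a positive integer and let $D$ be a finite digraph with girth $g$ and $\delta^+(D)\geq\delta$. Then $D$ contains a directed path of length at least $2\delta\left(1-\frac{1}{g}\right)$.
   Context: A digraph has arcs that are ordered pairs of vertices. $\delta^+(D)$ is the minimum out-degree of $D$. The girth is the minimum length of a directed cycle. The length of a path is its number of arcs. -}

module Defs where

open import Data.Nat using (ℕ; _∸_)
open import Data.Bool using (Bool; true)
open import Data.Fin using (Fin)
open import Data.List using (List; []; _∷_; _++_; [_]; length; filterᵇ; allFin)
open import Data.List.Relation.Unary.Unique.Propositional using (Unique)
open import Data.Product using (_×_; Σ)
open import Data.Unit using (⊤)
open import Relation.Binary.PropositionalEquality using (_≡_)

Digraph : ℕ → Set
Digraph n = Fin n → Fin n → Bool

Arc : ∀ {n} → Digraph n → Fin n → Fin n → Set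
Arc A u v = A u v ≡ true

outdeg : ∀ {n} → Digraph n → Fin n → ℕ
outdeg {n} A u = length (filterᵇ (A u) (allFin n))

MinOutdegGE : ∀ {n} → Digraph n → ℕ → Set
MinOutdegGE {n} A d = (u : Fin n) → d Data.Nat.≤ outdeg A u

Chain : ∀ {n} → Digraph n → List (Fin n) → Set
Chain A [] = ⊤
Chain A (u ∷ []) = ⊤
Chain A (u ∷ v ∷ vs) = Arc A u v × Chain A (v ∷ vs)

-- directed path given by its (nonempty) vertex sequence v ∷ vs, vertices distinct;
-- its length is the number of arcs, i.e. length vs
IsPath : ∀ {n} → Digraph n → Fin n → List (Fin n) → Set
IsPath A v vs = Unique (v ∷ vs) × Chain A (v ∷ vs)

-- directed cycle v → w₁ → … → wₖ → v with distinct vertices v, w₁, …, wₖ;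
-- its length is the number of arcs, i.e. length (v ∷ ws)  (a loop has length 1)
IsCycle : ∀ {n} → Digraph n → Fin n → List (Fin n) → Set
IsCycle A v ws = Unique (v ∷ ws) × Chain A (v ∷ ws ++ [ v ])

HasGirth : ∀ {n} → Digraph n → ℕ → Set
HasGirth {n} A g =
  Σ (Fin n) (λ v → Σ (List (Fin n)) (λ ws → IsCycle A v ws × length (v ∷ ws) ≡ g))
  × ((v : Fin n) (ws : List (Fin n)) → IsCycle A v ws → g Data.Nat.≤ length (v ∷ ws))

{-# OPTIONS --safe #-}
-- Restrict to a terminal strong component and take there a "lollipop": a path Q entering a
-- cycle C with |C| ≥ δ, chosen with |Q| + |C| maximal and then |C| maximal.
-- If the last vertex x of Q has an out-neighbour outside Q ∪ C, a maximal continuation of Q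
-- through it either returns to C, giving a longer path, or closes a cycle of length at least δ
-- disjoint from C; linking the two cycles gives a path on at least 2δ vertices.
-- Otherwise at least δ − |Q| vertices v of C have their successor on C in N⁺(x) (if Q is empty,
-- any v will do), and for each of them N⁺(v) ⊆ C, since entering C at the successor of v gives
-- a path on Q ∪ C ending in v.
-- A set S of δ − |Q| such vertices induces a digraph of minimum out-degree at least
-- 2δ − |Q| − |C|, and the Chvátal–Szemerédi bound 2|S| / (r + 1) for the girth of a digraph on S
-- of minimum out-degree r yields the claim.
module Submission where

open import Defs
open import Data.Bool using (Bool; true; false; _∧_; _∨_)
open import Data.Bool.Properties using (T-≡; ∨-zeroʳ)
import Data.Bool.Properties as Bool
open import Data.Empty using (⊥-elim)
open import Data.Fin using (Fin)
import Data.Fin.Properties as Fin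
open import Data.List using (List; []; _∷_; _++_; [_]; length; filter; filterᵇ; allFin; map; take; InitLast; initLast; _∷ʳ′_)
open import Data.List.Properties using (length-++; length-filter; length-take; length-tabulate; take++drop≡id; filter-all; ++-assoc; ++-identityʳ; ∷ʳ-injective)
open import Data.List.Membership.Propositional using (_∈_; _∉_; find; lose)
open import Data.List.Membership.Propositional.Properties using (∈-filter⁺; ∈-filter⁻; ∈-++⁺ˡ; ∈-++⁺ʳ; ∈-++⁻; ∈-∃++; ∈-allFin)
open import Data.List.Relation.Binary.Disjoint.Propositional using (Disjoint)
open import Data.List.Relation.Binary.Permutation.Propositional using (_↭_; ↭-sym; ↭-trans; ↭-refl; ↭⇒↭ₛ)
open import Data.List.Relation.Binary.Permutation.Propositional.Properties using (↭-length; ∈-resp-↭; ++⁺ˡ; ++-comm; ∷↭∷ʳ; filter-↭)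
import Data.List.Relation.Binary.Permutation.Setoid.Properties as Permₛ
open import Data.List.Relation.Binary.Subset.Propositional using (_⊆_)
open import Data.List.Relation.Unary.All using ([]; _∷_)
import Data.List.Relation.Unary.All as All
import Data.List.Relation.Unary.All.Properties as All
open import Data.List.Relation.Unary.AllPairs using ([]; _∷_)
open import Data.List.Relation.Unary.Any using (Any; here; there; any?)
open import Data.List.Relation.Unary.Unique.Propositional using (Unique)
import Data.List.Relation.Unary.Unique.Propositional.Properties as Unique
open import Data.Nat using (ℕ; zero; suc; _+_; _*_; _∸_; _≤_; _<_; z≤n; s≤s; s≤s⁻¹; _≤?_; _<?_)
open import Data.Nat.ListAction using (sum)
open import Data.Nat.Properties
open import Data.Nat.Solver using (module +-*-Solver)
open import Data.Product using (Σ; ∃; ∃₂; _×_; _,_; proj₁; proj₂)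
open import Data.Sum using (_⊎_; inj₁; inj₂; [_,_]′)
open import Data.Unit using (tt)
open import Function using (_∘_; Equivalence)
open import Relation.Binary.PropositionalEquality using (_≡_; _≢_; refl; sym; trans; cong; cong₂; subst; setoid; module ≡-Reasoning)
open import Relation.Nullary using (¬_; Dec; yes; no; does; contradiction; ¬?; _×-dec_; _→-dec_)
open import Relation.Unary using (Decidable)
open +-*-Solver using (solve; _:+_; _:*_; _:=_; con)

private
  variable
    X : Set
    n k l : ℕ
    A E : Digraph n

-- Finite lists and double counting.

_∈?_ : ∀ (x : Fin n) xs → Dec (x ∈ xs)
x ∈? xs = any? (x Fin.≟_) xs

∈-filterᵇ⁺ : ∀ (p : X → Bool) {x xs} → x ∈ xs → p x ≡ true → x ∈ filterᵇ p xs
∈-filterᵇ⁺ p x∈ px = ∈-filter⁺ _ x∈ (Equivalence.from T-≡ px)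

∈-filterᵇ⁻ : ∀ (p : X → Bool) {x xs} → x ∈ filterᵇ p xs → x ∈ xs × p x ≡ true
∈-filterᵇ⁻ p x∈ with ∈-filter⁻ _ x∈
... | x∈xs , px = x∈xs , Equivalence.to T-≡ px

Unique-⊆⇒length≤ : {xs ys : List X} → Unique xs → xs ⊆ ys → length xs ≤ length ys
Unique-⊆⇒length≤ {xs = []} [] _ = z≤n
Unique-⊆⇒length≤ {xs = x ∷ xs} {ys} (x# ∷ u) sub with ∈-∃++ (sub (here refl))
... | as , bs , refl = begin
  suc (length xs)               ≤⟨ s≤s (Unique-⊆⇒length≤ u sub′) ⟩
  suc (length (as ++ bs))       ≡⟨ cong suc (length-++ as) ⟩
  suc (length as + length bs)   ≡⟨ +-suc (length as) (length bs) ⟨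
  length as + suc (length bs)   ≡⟨ length-++ as ⟨
  length (as ++ x ∷ bs)         ∎
  where
  open ≤-Reasoning
  sub′ : xs ⊆ as ++ bs
  sub′ {y} y∈ with ∈-++⁻ as (sub (there y∈))
  ... | inj₁ p = ∈-++⁺ˡ p
  ... | inj₂ (here refl) = ⊥-elim (All.lookup x# y∈ refl)
  ... | inj₂ (there p) = ∈-++⁺ʳ as p

length-filterᵇ-∷ : ∀ (p : X → Bool) x xs →
  length (filterᵇ p (x ∷ xs)) ≡ length (filterᵇ p [ x ]) + length (filterᵇ p xs)
length-filterᵇ-∷ p x xs with p x
... | true = refl
... | false = refl

sum-map-+ : ∀ (f g : X → ℕ) xs → sum (map (λ x → f x + g x) xs) ≡ sum (map f xs) + sum (map g xs)
sum-map-+ f g [] = refl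
sum-map-+ f g (x ∷ xs) rewrite sum-map-+ f g xs =
  solve 4 (λ a b c d → (a :+ b) :+ (c :+ d) := (a :+ c) :+ (b :+ d)) refl
    (f x) (g x) (sum (map f xs)) (sum (map g xs))

sum-map-≤ : ∀ (f : X → ℕ) r xs → (∀ {x} → x ∈ xs → f x ≤ r) → sum (map f xs) ≤ length xs * r
sum-map-≤ f r [] h = z≤n
sum-map-≤ f r (x ∷ xs) h = +-mono-≤ (h (here refl)) (sum-map-≤ f r xs (h ∘ there))

sum-map-≥ : ∀ (f : X → ℕ) r xs → (∀ {x} → x ∈ xs → r ≤ f x) → length xs * r ≤ sum (map f xs)
sum-map-≥ f r [] h = z≤n
sum-map-≥ f r (x ∷ xs) h = +-mono-≤ (h (here refl)) (sum-map-≥ f r xs (h ∘ there))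

sum-map-0 : ∀ (ys : List X) → sum (map (λ _ → 0) ys) ≡ 0
sum-map-0 [] = refl
sum-map-0 (_ ∷ ys) = sum-map-0 ys

sum-map-cong : ∀ {f g : X → ℕ} → (∀ x → f x ≡ g x) → ∀ xs → sum (map f xs) ≡ sum (map g xs)
sum-map-cong eq [] = refl
sum-map-cong eq (x ∷ xs) = cong₂ _+_ (eq x) (sum-map-cong eq xs)

length-filterᵇ-sum : ∀ (p : X → Bool) ys →
  length (filterᵇ p ys) ≡ sum (map (λ y → length (filterᵇ p [ y ])) ys)
length-filterᵇ-sum p [] = refl
length-filterᵇ-sum p (y ∷ ys) =
  trans (length-filterᵇ-∷ p y ys) (cong (_ +_) (length-filterᵇ-sum p ys))

length-filterᵇ-[]-swap : ∀ (R : X → X → Bool) x y →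
  length (filterᵇ (R x) [ y ]) ≡ length (filterᵇ (λ x′ → R x′ y) [ x ])
length-filterᵇ-[]-swap R x y with R x y
... | true = refl
... | false = refl

double-counting : ∀ (R : X → X → Bool) xs ys →
  sum (map (λ x → length (filterᵇ (R x) ys)) xs) ≡
  sum (map (λ y → length (filterᵇ (λ x → R x y) xs)) ys)
double-counting R [] ys = sym (sum-map-0 ys)
double-counting R (x ∷ xs) ys = begin
  length (filterᵇ (R x) ys) + sum (map (λ x′ → length (filterᵇ (R x′) ys)) xs)
    ≡⟨ cong₂ _+_ (length-filterᵇ-sum (R x) ys) (double-counting R xs ys) ⟩
  sum (map (λ y → length (filterᵇ (R x) [ y ])) ys) + sum (map (λ y → length (filterᵇ (λ x′ → R x′ y) xs)) ys)
    ≡⟨ sum-map-+ _ _ ys ⟨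
  sum (map (λ y → length (filterᵇ (R x) [ y ]) + length (filterᵇ (λ x′ → R x′ y) xs)) ys)
    ≡⟨ sum-map-cong (λ y → trans
         (cong (_+ _) (length-filterᵇ-[]-swap R x y))
         (sym (length-filterᵇ-∷ (λ x′ → R x′ y) x xs))) ys ⟩
  sum (map (λ y → length (filterᵇ (λ x′ → R x′ y) (x ∷ xs))) ys) ∎
  where open ≡-Reasoning

-- Averaging: in-degrees and out-degrees inside `S` have the same sum, which would be too small if
-- every in-degree were below the lower bound on the out-degrees.
large-indegree : ∀ (R : X → X → Bool) S r → 0 < length S →
  (∀ {v} → v ∈ S → r ≤ length (filterᵇ (R v) S)) →
  ∃ λ w → w ∈ S × r ≤ length (filterᵇ (λ v → R v w) S)
large-indegree R S zero 0<S _ with S | 0<S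
... | w ∷ _ | _ = w , here refl , z≤n
large-indegree R S (suc r) 0<S deg with any? (λ w → suc r ≤? length (filterᵇ (λ v → R v w) S)) S
... | yes p = find p
... | no ¬p = contradiction (begin-strict
    length S * r      <⟨ m<n+m (length S * r) 0<S ⟩
    length S + length S * r ≡⟨ *-suc (length S) r ⟨
    length S * suc r  ≤⟨ sum-map-≥ _ (suc r) S deg ⟩
    sum (map (λ v → length (filterᵇ (R v) S)) S) ≡⟨ double-counting R S S ⟩
    sum (map (λ w → length (filterᵇ (λ v → R v w) S)) S)
      ≤⟨ sum-map-≤ _ r S (λ w∈ → s≤s⁻¹ (≰⇒> (λ h → ¬p (lose w∈ h)))) ⟩
    length S * r      ∎) (<-irrefl refl)
  where open ≤-Reasoning

-- Walks and the Chvátal-Szemerédi girth bound.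

data Walk {n} (E : Digraph n) : ℕ → Fin n → Fin n → Set where
  []  : ∀ {u} → Walk E 0 u u
  _∷_ : ∀ {k u v w} → Arc E u v → Walk E k v w → Walk E (suc k) u w

_++ʷ_ : ∀ {u v w} → Walk E k u v → Walk E l v w → Walk E (k + l) u w
[] ++ʷ q = q
(e ∷ p) ++ʷ q = e ∷ (p ++ʷ q)

-- Shortcut arcs x → y stand for walks of length 3 through w; cutting out everything between
-- the first and the last visit of w leaves two walks of E.
unshortcut : ∀ {E E′ : Digraph n} {w} →
  (∀ {x y} → Arc E′ x y → Arc E x y ⊎ (Walk E 2 x w × Arc E w y)) →
  ∀ {u v} → Walk E′ k u v →
  Walk E k u v ⊎ ∃₂ λ i j → i + j < k × Walk E (i + 2) u w × Walk E (suc j) w v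
unshortcut arc [] = inj₁ []
unshortcut arc (e ∷ p) with arc e | unshortcut arc p
... | inj₁ a | inj₁ q = inj₁ (a ∷ q)
... | inj₁ a | inj₂ (i , j , i+j<k , q , q′) = inj₂ (suc i , j , s≤s i+j<k , a ∷ q , q′)
... | inj₂ (b , c) | inj₁ q = inj₂ (0 , _ , ≤-refl , b , c ∷ q)
... | inj₂ (b , c) | inj₂ (i , j , i+j<k , q , q′) =
  inj₂ (0 , j , m≤n⇒m≤1+n (≤-<-trans (m≤n+m j i) i+j<k) , b , q′)

Arc? : ∀ (E : Digraph n) u v → Dec (Arc E u v)
Arc? E u v = E u v Bool.≟ true

module Contract {n : ℕ} (E : Digraph n) (S : List (Fin n)) (w : Fin n) where
  toIn? : ∀ x → Dec (Any (λ a → Arc E x a × Arc E a w) S)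
  toIn? x = any? (λ a → Arc? E x a ×-dec Arc? E a w) S

  -- Arcs are only added here. The deletion of `w` and its in-neighbours is left to the vertex list
  -- `S′`, so that every stage of the induction lives on `Fin n`.
  E′ : Digraph n
  E′ x y = E x y ∨ (E w y ∧ does (toIn? x))

  keep? : ∀ v → Dec (v ≢ w × ¬ Arc E v w)
  keep? v = ¬? (v Fin.≟ w) ×-dec ¬? (Arc? E v w)

  S′ : List (Fin n)
  S′ = filter keep? S

  E′-sound : ∀ {x y} → Arc E′ x y → Arc E x y ⊎ (Walk E 2 x w × Arc E w y)
  E′-sound {x} {y} e with E x y | E w y | toIn? x
  ... | true | _ | _ = inj₁ refl
  ... | false | true | yes p with find p
  ...   | a , _ , xa , aw = inj₂ (xa ∷ aw ∷ [] , refl)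
  E′-sound {x} {y} () | false | true | no _
  E′-sound {x} {y} () | false | false | _

  E′-old : ∀ {x y} → Arc E x y → Arc E′ x y
  E′-old e rewrite e = refl

  E′-new : ∀ {x y} → Any (λ a → Arc E x a × Arc E a w) S → Arc E w y → Arc E′ x y
  E′-new {x} {y} p e with toIn? x
  ... | yes _ rewrite e = ∨-zeroʳ (E x y)
  ... | no ¬p = contradiction p ¬p

  module _ (w∈S : w ∈ S) (noLoop : ¬ Arc E w w)
           (no2 : ∀ {a} → a ∈ S → Arc E w a → ¬ Arc E a w) (US : Unique S) where

    -- The absence of a loop at `w` and of 2-cycles through `w` is what lets the out-neighbours of
    -- `w` survive; redirected vertices then find all of them in `S′`.
    out⊆S′ : filterᵇ (E w) S ⊆ S′
    out⊆S′ b∈ with ∈-filterᵇ⁻ (E w) b∈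
    ... | b∈S , wb = ∈-filter⁺ keep? b∈S ((λ { refl → noLoop wb }) , no2 b∈S wb)

    S′-length : suc (length (filterᵇ (λ v → E v w) S)) + length S′ ≤ length S
    S′-length = begin
      suc (length In) + length S′ ≡⟨ length-++ (w ∷ In) ⟨
      length ((w ∷ In) ++ S′)     ≤⟨ Unique-⊆⇒length≤ unique sub ⟩
      length S                    ∎
      where
      open ≤-Reasoning
      In : List (Fin n)
      In = filterᵇ (λ v → E v w) S
      sub : (w ∷ In) ++ S′ ⊆ S
      sub x∈ with ∈-++⁻ (w ∷ In) x∈
      ... | inj₁ (here refl) = w∈S
      ... | inj₁ (there p) = proj₁ (∈-filterᵇ⁻ _ p)
      ... | inj₂ p = proj₁ (∈-filter⁻ keep? p)
      unique : Unique ((w ∷ In) ++ S′)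
      unique = Unique.++⁺
        (All.tabulate (λ { p refl → noLoop (proj₂ (∈-filterᵇ⁻ (λ v → E v w) {xs = S} p)) })
          ∷ Unique.filter⁺ _ US)
        (Unique.filter⁺ keep? US)
        λ { (here refl , q) → proj₁ (proj₂ (∈-filter⁻ keep? {xs = S} q)) refl
          ; (there p , q) → proj₂ (proj₂ (∈-filter⁻ keep? {xs = S} q)) (proj₂ (∈-filterᵇ⁻ (λ v → E v w) {xs = S} p)) }

    -- A surviving `x` with an arc to some in-neighbour of `w` gains all of the surviving set N⁺(w).
    -- Any other surviving `x` has no arc to a deleted vertex, since it is not an in-neighbour of
    -- `w` either.
    S′-degree : ∀ {r} → (∀ {v} → v ∈ S → r ≤ length (filterᵇ (E v) S)) →
      ∀ {x} → x ∈ S′ → r ≤ length (filterᵇ (E′ x) S′)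
    S′-degree {r} deg {x} x∈ = byCases (toIn? x)
      where
      x∈S : x ∈ S
      x∈S = proj₁ (∈-filter⁻ keep? x∈)
      ¬xw : ¬ Arc E x w
      ¬xw = proj₂ (proj₂ (∈-filter⁻ keep? {xs = S} x∈))
      byCases : Dec (Any (λ a → Arc E x a × Arc E a w) S) → r ≤ length (filterᵇ (E′ x) S′)
      byCases (yes p) = ≤-trans (deg w∈S) (Unique-⊆⇒length≤ (Unique.filter⁺ _ US)
        λ b∈ → ∈-filterᵇ⁺ (E′ x) (out⊆S′ b∈) (E′-new p (proj₂ (∈-filterᵇ⁻ (E w) {xs = S} b∈))))
      byCases (no ¬p) = ≤-trans (deg x∈S) (Unique-⊆⇒length≤ (Unique.filter⁺ _ US) sub)
        where
        sub : filterᵇ (E x) S ⊆ filterᵇ (E′ x) S′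
        sub y∈ with ∈-filterᵇ⁻ (E x) y∈
        ... | y∈S , xy = ∈-filterᵇ⁺ (E′ x)
          (∈-filter⁺ keep? y∈S ((λ { refl → ¬xw xy }) , λ yw → ¬p (lose y∈S (xy , yw))))
          (E′-old xy)

-- When shortcuts occur, the two pieces u → w and w → u are glued at `u`, so the base point moves to
-- `w`; the length is (j + 1) + (i + 2) with i + j ≤ k.
unshortcut-closed : ∀ {E E′ : Digraph n} {w} →
  (∀ {x y} → Arc E′ x y → Arc E x y ⊎ (Walk E 2 x w × Arc E w y)) →
  ∀ {u} → Walk E′ (suc k) u u → ∃₂ λ v j → j ≤ k + 2 × Walk E (suc j) v v
unshortcut-closed {k = k} arc {u} p with unshortcut arc p
... | inj₁ q = u , k , m≤m+n k 2 , q
... | inj₂ (i , j , i+j<k , q , q′) = _ , _ ,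
  (begin
    j + (i + 2) ≡⟨ solve 2 (λ i j → j :+ (i :+ con 2) := (i :+ j) :+ con 2) refl i j ⟩
    (i + j) + 2 ≤⟨ +-monoˡ-≤ 2 (s≤s⁻¹ i+j<k) ⟩
    k + 2       ∎) , q′ ++ʷ q
  where open ≤-Reasoning

-- Chvátal–Szemerédi: delete a vertex w of in-degree at least r together with its in-neighbours A,
-- and redirect each vertex with an arc into A to all of N⁺(w). This removes r + 1 vertices and
-- lengthens a shortest closed walk by at most 2.
short-closed-walk : ∀ m (E : Digraph n) S r → length S ≤ m → Unique S → 0 < r → 0 < length S →
  (∀ {v} → v ∈ S → r ≤ length (filterᵇ (E v) S)) →
  ∃₂ λ u k → Walk E (suc k) u u × suc k * suc r ≤ 2 * length S
short-closed-walk zero E S r S≤m _ _ 0<S _ = contradiction (≤-trans 0<S S≤m) λ ()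
short-closed-walk (suc m) E S r S≤m US 0<r 0<S deg with large-indegree E S r 0<S deg
... | w , w∈S , r≤in with Arc? E w w
... | yes loop = w , 0 , loop ∷ [] , (begin
    1 * suc r           ≡⟨ *-identityˡ (suc r) ⟩
    1 + r               ≤⟨ +-mono-≤ 0<S (≤-trans r≤in (length-filter _ S)) ⟩
    length S + length S ≡⟨ cong (length S +_) (+-identityʳ (length S)) ⟨
    2 * length S        ∎)
  where open ≤-Reasoning
... | no noLoop with any? (λ a → Arc? E w a ×-dec Arc? E a w) S
... | yes p = w , 1 , proj₁ (proj₂ (proj₂ (find p))) ∷ proj₂ (proj₂ (proj₂ (find p))) ∷ [] ,
  *-monoʳ-≤ 2 (begin
    suc r                            ≤⟨ s≤s (deg w∈S) ⟩
    length (w ∷ filterᵇ (E w) S)     ≤⟨ Unique-⊆⇒length≤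
      (All.tabulate (λ { q refl → noLoop (proj₂ (∈-filterᵇ⁻ (E w) {xs = S} q)) }) ∷ Unique.filter⁺ _ US)
      (λ { (here refl) → w∈S ; (there q) → proj₁ (∈-filterᵇ⁻ (E w) q) }) ⟩
    length S                         ∎)
  where open ≤-Reasoning
... | no ¬p = contracted
  where
  open Contract E S w
  open ≤-Reasoning
  no2 : ∀ {a} → a ∈ S → Arc E w a → ¬ Arc E a w
  no2 a∈ wa aw = ¬p (lose a∈ (wa , aw))
  len : suc (length (filterᵇ (λ v → E v w) S)) + length S′ ≤ length S
  len = S′-length w∈S noLoop no2 US
  contracted : ∃₂ λ u k → Walk E (suc k) u u × suc k * suc r ≤ 2 * length S
  -- The recursive call is legitimate because `w` has left the list, and `S′` is nonempty because it
  -- contains the out-neighbours of `w`.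
  contracted with short-closed-walk m E′ S′ r
         (s≤s⁻¹ (≤-trans (≤-trans (s≤s (m≤n+m (length S′) _)) len) S≤m))
         (Unique.filter⁺ keep? US) 0<r
         (≤-trans 0<r (≤-trans (deg w∈S)
           (Unique-⊆⇒length≤ (Unique.filter⁺ _ US) (out⊆S′ w∈S noLoop no2 US))))
         (S′-degree w∈S noLoop no2 US deg)
  ... | u , k , p , k≤ with unshortcut-closed E′-sound p
  ...   | v , j , j≤ , q = v , j , q , (begin
    suc j * suc r             ≤⟨ *-monoˡ-≤ (suc r) (s≤s j≤) ⟩
    (suc k + 2) * suc r       ≡⟨ *-distribʳ-+ (suc r) (suc k) 2 ⟩
    suc k * suc r + 2 * suc r ≤⟨ +-monoˡ-≤ (2 * suc r) k≤ ⟩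
    2 * length S′ + 2 * suc r ≡⟨ *-distribˡ-+ 2 (length S′) (suc r) ⟨
    2 * (length S′ + suc r)   ≡⟨ cong (2 *_) (+-comm (length S′) (suc r)) ⟩
    2 * (suc r + length S′)   ≤⟨ *-monoʳ-≤ 2 (≤-trans (+-monoˡ-≤ (length S′) (s≤s r≤in)) len) ⟩
    2 * length S              ∎)

-- Lists without repetition, splittings and shifted counts.

Unique-resp-↭ : {xs ys : List X} → xs ↭ ys → Unique xs → Unique ys
Unique-resp-↭ p = Permₛ.Unique-resp-↭ (setoid _) (↭⇒↭ₛ p)

Unique-++⁻ : ∀ (xs : List X) {ys} → Unique (xs ++ ys) → Unique xs × Unique ys × Disjoint xs ys
Unique-++⁻ [] u = [] , u , λ ()
Unique-++⁻ (x ∷ xs) (x# ∷ u) with Unique-++⁻ xs u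
... | uxs , uys , dis = All.++⁻ˡ xs x# ∷ uxs , uys ,
  λ { (here refl , q) → All.lookup (All.++⁻ʳ xs x#) q refl ; (there p , q) → dis (p , q) }

Unique-∷ʳ⁺ : ∀ {xs : List X} {y} → Unique xs → y ∉ xs → Unique (xs ++ [ y ])
Unique-∷ʳ⁺ u y∉ = Unique.++⁺ u ([] ∷ []) λ { (p , here refl) → y∉ p }

length-∷ʳ : ∀ (xs : List X) y → length (xs ++ [ y ]) ≡ suc (length xs)
length-∷ʳ xs y = trans (length-++ xs) (+-comm (length xs) 1)

Unique⇒length≤ : {xs : List (Fin n)} → Unique xs → length xs ≤ n
Unique⇒length≤ {n} {xs} u =
  subst (length xs ≤_) (length-tabulate {n = n} (λ i → i)) (Unique-⊆⇒length≤ u (λ {x} _ → ∈-allFin x))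

first-split : ∀ {P : X → Set} → Decidable P → ∀ {xs} → Any P xs →
  ∃₂ λ as y → ∃ λ bs → xs ≡ as ++ y ∷ bs × P y × (∀ {x} → x ∈ as → ¬ P x)
first-split P? {x ∷ xs} p with P? x
... | yes px = [] , x , xs , refl , px , λ ()
first-split P? {x ∷ xs} (here px) | no ¬px = contradiction px ¬px
first-split P? {x ∷ xs} (there p) | no ¬px with first-split P? p
... | as , y , bs , refl , py , none =
  x ∷ as , y , bs , refl , py , λ { (here refl) → ¬px ; (there q) → none q }

unique-or-repeat : ∀ (xs : List (Fin n)) →
  Unique xs ⊎ ∃₂ λ as y → ∃₂ λ bs cs → xs ≡ as ++ y ∷ bs ++ y ∷ cs
unique-or-repeat [] = inj₁ []
unique-or-repeat (x ∷ xs) with x ∈? xs | unique-or-repeat xs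
... | yes x∈ | _ = let bs , cs , eq = ∈-∃++ x∈ in inj₂ ([] , x , bs , cs , cong (x ∷_) eq)
... | no x∉ | inj₁ u = inj₁ (All.¬Any⇒All¬ xs x∉ ∷ u)
... | no x∉ | inj₂ (as , y , bs , cs , eq) = inj₂ (x ∷ as , y , bs , cs , cong (x ∷_) eq)

-- Here `X` will be the final goal: a vertex that fails the property is expected to yield it
-- outright, which replaces arguments by contradiction.
all-or : ∀ {P : Fin n → Set} → (∀ i → P i ⊎ X) → (∀ i → P i) ⊎ X
all-or {n = zero} f = inj₁ λ ()
all-or {n = suc n} f with f Fin.zero | all-or (f ∘ Fin.suc)
... | inj₂ x | _ = inj₂ x
... | inj₁ _ | inj₂ x = inj₂ x
... | inj₁ p | inj₁ q = inj₁ λ { Fin.zero → p ; (Fin.suc i) → q i }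

-- Each entry satisfying `P` is charged to its predecessor, which satisfies `G`. With `z` equal to
-- `x` this is the cyclic shift along a cycle.
count-shift : ∀ {P G : X → Set} (P? : Decidable P) (G? : Decidable G) {Z : Set} x xs z →
  (∀ as v w bs → x ∷ xs ++ [ z ] ≡ as ++ v ∷ w ∷ bs → P w → G v ⊎ Z) →
  (length (filter P? (xs ++ [ z ])) ≤ length (filter G? (x ∷ xs))) ⊎ Z
count-shift P? G? x [] z h with P? z | G? x
... | no _ | _ = inj₁ z≤n
... | yes _ | yes _ = inj₁ ≤-refl
... | yes p | no ¬g with h [] x z [] refl p
...   | inj₁ g = contradiction g ¬g
...   | inj₂ e = inj₂ e
count-shift P? G? x (y ∷ xs) z h
  with count-shift P? G? y xs z (λ as v w bs eq → h (x ∷ as) v w bs (cong (x ∷_) eq)) | P? y | G? x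
... | inj₂ e | _ | _ = inj₂ e
... | inj₁ ih | no _ | no _ = inj₁ ih
... | inj₁ ih | no _ | yes _ = inj₁ (m≤n⇒m≤1+n ih)
... | inj₁ ih | yes _ | yes _ = inj₁ (s≤s ih)
... | inj₁ ih | yes p | no ¬g with h [] x y _ refl p
...   | inj₁ g = contradiction g ¬g
...   | inj₂ e = inj₂ e

-- Cutting, joining and rotating chains.

chain-split : ∀ xs {y ys} → Chain A (xs ++ y ∷ ys) → Chain A (xs ++ [ y ]) × Chain A (y ∷ ys)
chain-split [] c = tt , c
chain-split (x ∷ []) (a , c) = (a , tt) , c
chain-split (x ∷ x′ ∷ xs) (a , c) with chain-split (x′ ∷ xs) c
... | c₁ , c₂ = (a , c₁) , c₂

chain-join : ∀ xs {y ys} → Chain A (xs ++ [ y ]) → Chain A (y ∷ ys) → Chain A (xs ++ y ∷ ys)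
chain-join [] _ c = c
chain-join (x ∷ []) (a , _) c = a , c
chain-join (x ∷ x′ ∷ xs) (a , c₁) c₂ = a , chain-join (x′ ∷ xs) c₁ c₂

chain-tail : ∀ {x} xs → Chain A (x ∷ xs) → Chain A xs
chain-tail [] _ = tt
chain-tail (_ ∷ _) (_ , c) = c

chain-init : ∀ xs {ys} → Chain A (xs ++ ys) → Chain A xs
chain-init [] _ = tt
chain-init (x ∷ []) _ = tt
chain-init (x ∷ x′ ∷ xs) (a , c) = a , chain-init (x′ ∷ xs) c

-- z is the last vertex of the chain l, phrased so that no list equation is needed.
Extends : Digraph n → List (Fin n) → Fin n → Set
Extends A l z = ∀ {u} → Arc A z u → Chain A (l ++ [ u ])

extends-∷ʳ : ∀ l {z} → Chain A (l ++ [ z ]) → Extends A (l ++ [ z ]) z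
extends-∷ʳ {A = A} l {z} c {u} a =
  subst (Chain A) (sym (++-assoc l [ z ] [ u ])) (chain-join l c (a , tt))

extends-++ : ∀ xs {y ys v} → Chain A (xs ++ [ y ]) → Extends A (y ∷ ys) v → Extends A (xs ++ y ∷ ys) v
extends-++ {A = A} xs {y} {ys} c e {u} a =
  subst (Chain A) (sym (++-assoc xs (y ∷ ys) [ u ])) (chain-join xs c (e a))

rotate : ∀ {h cs} xs {v ys} → h ∷ cs ≡ xs ++ v ∷ ys →
  Chain A (h ∷ cs ++ [ h ]) → Chain A (v ∷ (ys ++ xs) ++ [ v ])
rotate {A = A} [] {v} {ys} refl c = subst (λ zs → Chain A (v ∷ zs ++ [ v ])) (sym (++-identityʳ ys)) c
rotate {A = A} (h ∷ xs) {v} {ys} refl c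
  with chain-split (h ∷ xs) (subst (Chain A) (++-assoc (h ∷ xs) (v ∷ ys) [ h ]) c)
... | c₁ , c₂ = subst (Chain A) (sym (++-assoc (v ∷ ys) (h ∷ xs) [ v ])) (chain-join (v ∷ ys) c₂ c₁)

rotate-to : ∀ {h cs v} → v ∈ h ∷ cs → Chain A (h ∷ cs ++ [ h ]) →
  ∃ λ ds → Chain A (v ∷ ds ++ [ v ]) × v ∷ ds ↭ h ∷ cs
rotate-to {A = A} {v = v} v∈ c with ∈-∃++ v∈
... | xs , ys , eq = ys ++ xs , rotate {A = A} xs eq c ,
  subst (v ∷ ys ++ xs ↭_) (sym eq) (++-comm (v ∷ ys) xs)

-- Read from `w` onwards, the cycle ends in the predecessor `v` of `w`. This is the form in which a
-- stem enters a cycle at `w` and runs all the way round to `v`.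
rotate-after : ∀ {h cs} as v w bs → Chain A (h ∷ cs ++ [ h ]) → h ∷ cs ++ [ h ] ≡ as ++ v ∷ w ∷ bs →
  ∃ λ ds → w ∷ ds ↭ h ∷ cs × Chain A (w ∷ ds) × Extends A (w ∷ ds) v
rotate-after {A = A} {h} {cs} as v w bs c eq with initLast bs
-- With nothing after it, `w` is the closing copy of `h`, and no rotation is required.
... | [] with ∷ʳ-injective (h ∷ cs) (as ++ [ v ]) (trans eq (sym (++-assoc as [ v ] [ w ])))
...   | eq₁ , refl = cs , ↭-refl , c₀ ,
        subst (λ zs → Extends A zs v) (sym eq₁) (extends-∷ʳ as (subst (Chain A) eq₁ c₀))
  where
  c₀ : Chain A (h ∷ cs)
  c₀ = chain-init (h ∷ cs) c
rotate-after {A = A} {h} {cs} as v w _ c eq | bs ∷ʳ′ z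
  with ∷ʳ-injective (h ∷ cs) ((as ++ [ v ]) ++ w ∷ bs)
         (trans eq (trans (sym (++-assoc as [ v ] _)) (sym (++-assoc (as ++ [ v ]) (w ∷ bs) [ z ]))))
... | eq₁ , refl = bs ++ as ++ [ v ] ,
      subst (w ∷ bs ++ as ++ [ v ] ↭_) (sym eq₁) (++-comm (w ∷ bs) (as ++ [ v ])) ,
      c₀ ,
      subst (λ zs → Extends A zs v) (++-assoc (w ∷ bs) as [ v ])
        (extends-∷ʳ (w ∷ bs ++ as) (subst (Chain A) (sym (++-assoc (w ∷ bs) as [ v ])) c₀))
  where
  c₀ : Chain A (w ∷ bs ++ as ++ [ v ])
  c₀ = chain-init (w ∷ bs ++ as ++ [ v ]) (rotate {A = A} (as ++ [ v ]) eq₁ c)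

-- From closed walks to cycles.

walk⇒chain : ∀ {u v} → Walk A (suc k) u v → ∃ λ ws → length ws ≡ k × Chain A (u ∷ ws ++ [ v ])
walk⇒chain (e ∷ []) = [] , refl , e , tt
walk⇒chain (_∷_ {v = w} e (f ∷ p)) with walk⇒chain (f ∷ p)
... | ws , eq , c = w ∷ ws , cong suc eq , e , c

-- The segment between two occurrences of a repeated vertex is a strictly shorter closed chain; `m`
-- serves both as recursion bound and as length bound for the result.
closed-chain⇒cycle : ∀ m {v ws} → length ws ≤ m → Chain A (v ∷ ws ++ [ v ]) →
  ∃₂ λ u us → IsCycle A u us × length us ≤ m
closed-chain⇒cycle {A = A} m {v} {ws} ws≤m c with unique-or-repeat (v ∷ ws)
... | inj₁ u = v , ws , (u , c) , ws≤m
... | inj₂ (as , y , bs , cs , eq) = descend m ws≤m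
  where
  c′ : Chain A (y ∷ bs ++ [ y ])
  c′ = proj₁ (chain-split (y ∷ bs) (subst (Chain A) (++-assoc (y ∷ bs) (y ∷ cs) [ v ])
         (proj₂ (chain-split as (subst (Chain A)
           (trans (cong (_++ [ v ]) eq) (++-assoc as (y ∷ bs ++ y ∷ cs) [ v ])) c)))))
  shorter : length bs < length ws
  shorter = s≤s⁻¹ (begin
    suc (suc (length bs))                ≤⟨ s≤s (s≤s (m≤m+n (length bs) (length cs))) ⟩
    suc (suc (length bs + length cs))    ≡⟨ cong suc (+-suc (length bs) (length cs)) ⟨
    suc (length bs + suc (length cs))    ≡⟨ cong suc (length-++ bs) ⟨
    length (y ∷ bs ++ y ∷ cs)            ≤⟨ m≤n+m _ (length as) ⟩
    length as + length (y ∷ bs ++ y ∷ cs) ≡⟨ length-++ as ⟨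
    length (as ++ y ∷ bs ++ y ∷ cs)      ≡⟨ cong length eq ⟨
    length (v ∷ ws)                      ∎)
    where open ≤-Reasoning
  descend : ∀ m → length ws ≤ m → ∃₂ λ u us → IsCycle A u us × length us ≤ m
  descend zero ws≤0 = contradiction (≤-trans shorter ws≤0) λ ()
  descend (suc m) ws≤1+m with closed-chain⇒cycle m (s≤s⁻¹ (≤-trans shorter ws≤1+m)) c′
  ... | u , us , cyc , us≤m = u , us , cyc , m≤n⇒m≤1+n us≤m

closed-walk⇒cycle : ∀ {u} → Walk A (suc k) u u → ∃₂ λ v ws → IsCycle A v ws × length (v ∷ ws) ≤ suc k
closed-walk⇒cycle p with walk⇒chain p
... | ws , refl , c with closed-chain⇒cycle _ ≤-refl c
...   | v , vs , cyc , vs≤ = v , vs , cyc , s≤s vs≤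

-- Linking two disjoint cycles.

record Link (A : Digraph n) (C C′ : List (Fin n)) : Set where
  field
    {p q} : Fin n
    ws    : List (Fin n)
    p∈C   : p ∈ C
    q∈C′  : q ∈ C′
    chain : Chain A (p ∷ ws ++ [ q ])
    uniq  : Unique ws
    offC  : Disjoint ws C
    offC′ : Disjoint ws C′

-- The walk is processed from its end. Unless a link is already found, the current vertex is in `C′`
-- or starts a path into `C′` that avoids both sets until its last vertex. Stepping back onto `C`
-- completes a link, stepping back onto `C′` starts afresh, and stepping back onto the path cuts off
-- a loop.
link-from : ∀ {C C′ : List (Fin n)} {u v} → v ∈ C′ → Walk A k u v →
  Link A C C′ ⊎ u ∈ C′ ⊎
  ∃₂ λ ws q → q ∈ C′ × Chain A (u ∷ ws ++ [ q ]) × Unique (u ∷ ws) × Disjoint (u ∷ ws) C × Disjoint (u ∷ ws) C′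
link-from v∈ [] = inj₂ (inj₁ v∈)
link-from {C = C} {C′} {u} v∈ (_∷_ {v = y} e p) with link-from {C = C} v∈ p | u ∈? C′ | u ∈? C
... | inj₁ lk | _ | _ = inj₁ lk
... | inj₂ _ | yes u∈C′ | _ = inj₂ (inj₁ u∈C′)
... | inj₂ (inj₁ y∈) | no _ | yes u∈C = inj₁ (record
  { ws = [] ; p∈C = u∈C ; q∈C′ = y∈ ; chain = e , tt ; uniq = [] ; offC = λ () ; offC′ = λ () })
... | inj₂ (inj₂ (ws , q , q∈ , c , uq , d , d′)) | no _ | yes u∈C = inj₁ (record
  { ws = y ∷ ws ; p∈C = u∈C ; q∈C′ = q∈ ; chain = e , c ; uniq = uq ; offC = d ; offC′ = d′ })
... | inj₂ (inj₁ y∈) | no u∉C′ | no u∉C = inj₂ (inj₂ ([] , y , y∈ , (e , tt) , [] ∷ [] ,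
  (λ { (here refl , r) → u∉C r }) , (λ { (here refl , r) → u∉C′ r })))
... | inj₂ (inj₂ (ws , q , q∈ , c , uq , d , d′)) | no u∉C′ | no u∉C with u ∈? (y ∷ ws)
...   | no u∉ = inj₂ (inj₂ (y ∷ ws , q , q∈ , (e , c) , All.¬Any⇒All¬ _ u∉ ∷ uq ,
  (λ { (here refl , r) → u∉C r ; (there r , s) → d (r , s) }) ,
  (λ { (here refl , r) → u∉C′ r ; (there r , s) → d′ (r , s) })))
link-from {A = A} {u = u} v∈ (_∷_ {v = y} e p)
    | inj₂ (inj₂ (ws , q , q∈ , c , uq , d , d′)) | no u∉C′ | no u∉C | yes u∈ with ∈-∃++ u∈
...     | as , bs , eq = inj₂ (inj₂ (bs , q , q∈ ,
  proj₂ (chain-split as (subst (Chain A) (trans (cong (_++ [ q ]) eq) (++-assoc as (u ∷ bs) [ q ])) c)) ,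
  proj₁ (proj₂ (Unique-++⁻ as (subst Unique eq uq))) ,
  (λ (r , s) → d (subst (_ ∈_) (sym eq) (∈-++⁺ʳ as r) , s)) ,
  (λ (r , s) → d′ (subst (_ ∈_) (sym eq) (∈-++⁺ʳ as r) , s))))

link-cycles : ∀ {C C′ : List (Fin n)} {u v} → Disjoint C C′ → u ∈ C → v ∈ C′ → Walk A k u v → Link A C C′
link-cycles {C = C} dis u∈ v∈ p with link-from {C = C} v∈ p
... | inj₁ lk = lk
... | inj₂ (inj₁ u∈C′) = ⊥-elim (dis (u∈ , u∈C′))
... | inj₂ (inj₂ (_ , _ , _ , _ , _ , d , _)) = ⊥-elim (d (here refl , u∈))

-- The first cycle is traversed so as to end at the link's start `p`, the second so as to begin at
-- its end `q`; the link in between only adds vertices.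
join-cycles : ∀ {h cs h′ cs′ u v} → IsCycle A h cs → IsCycle A h′ cs′ → Disjoint (h ∷ cs) (h′ ∷ cs′) →
  u ∈ h ∷ cs → v ∈ h′ ∷ cs′ → Walk A k u v →
  ∃ λ l → Unique l × Chain A l × length (h ∷ cs) + length (h′ ∷ cs′) ≤ length l
join-cycles {A = A} {h = h} {cs} {h′} {cs′} (U , c) (U′ , c′) dis u∈ v∈ walk
  with link-cycles {A = A} dis u∈ v∈ walk
... | lk with rotate-to {A = A} (Link.p∈C lk) c | rotate-to {A = A} (Link.q∈C′ lk) c′
...   | ds , cd , d↭ | es , ce , e↭ = (ds ++ [ p ]) ++ ws ++ q ∷ es ,
    Unique.++⁺ (Unique-resp-↭ (↭-sym dp↭) U)
      (Unique.++⁺ uniq (Unique-resp-↭ (↭-sym e↭) U′) (λ (r , s) → offC′ (r , ∈-resp-↭ e↭ s)))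
      (λ (r , s) → [ (λ s′ → offC (s′ , ∈-resp-↭ dp↭ r))
                   , (λ s′ → dis (∈-resp-↭ dp↭ r , ∈-resp-↭ e↭ s′)) ]′ (∈-++⁻ ws s)) ,
    subst (Chain A) (sym (++-assoc ds [ p ] (ws ++ q ∷ es)))
      (chain-join ds (chain-tail (ds ++ [ p ]) cd)
        (chain-join (p ∷ ws) chain (chain-init (q ∷ es) ce))) ,
    (begin
      length (h ∷ cs) + length (h′ ∷ cs′)         ≡⟨ cong₂ _+_ (↭-length dp↭) (↭-length e↭) ⟨
      length (ds ++ [ p ]) + length (q ∷ es)      ≤⟨ +-monoʳ-≤ (length (ds ++ [ p ])) (m≤n+m (length (q ∷ es)) (length ws)) ⟩
      length (ds ++ [ p ]) + (length ws + length (q ∷ es)) ≡⟨ cong (length (ds ++ [ p ]) +_) (length-++ ws) ⟨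
      length (ds ++ [ p ]) + length (ws ++ q ∷ es) ≡⟨ length-++ (ds ++ [ p ]) ⟨
      length ((ds ++ [ p ]) ++ ws ++ q ∷ es)      ∎)
  where
  open Link lk
  open ≤-Reasoning
  dp↭ : ds ++ [ p ] ↭ h ∷ cs
  dp↭ = ↭-trans (↭-sym (∷↭∷ʳ p ds)) d↭

-- Reachability and terminal strong components.

Reach : Digraph n → Fin n → Fin n → Set
Reach A u v = ∃ λ k → Walk A k u v

reach-∷ʳ : ∀ {u v w} → Reach A u v → Arc A v w → Reach A u w
reach-∷ʳ (k , p) e = k + 1 , p ++ʷ (e ∷ [])

Closed : Digraph n → List (Fin n) → Set
Closed A L = ∀ {u v} → u ∈ L → Arc A u v → v ∈ L

reach-∈ : ∀ {L u v} → Closed A L → u ∈ L → Walk A k u v → v ∈ L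
reach-∈ cl u∈ [] = u∈
reach-∈ {A = A} cl u∈ (e ∷ p) = reach-∈ {A = A} cl (cl u∈ e) p

record ReachSet (A : Digraph n) (v : Fin n) : Set where
  field
    set    : List (Fin n)
    start  : v ∈ set
    uniq   : Unique set
    sound  : ∀ {u} → u ∈ set → Reach A v u
    closed : Closed A set

-- The fuel `m` cannot run out early, because a repetition-free list has at most `n` entries.
grow-reachSet : ∀ m {v : Fin n} L → n ≤ m + length L → v ∈ L → Unique L →
  (∀ {u} → u ∈ L → Reach A v u) → ReachSet A v
grow-reachSet {A = A} m L n≤ v∈ U snd
  with Fin.any? (λ u → Fin.any? (λ w → u ∈? L ×-dec (Arc? A u w ×-dec ¬? (w ∈? L))))
... | no ¬p = record { set = L ; start = v∈ ; uniq = U ; sound = snd ; closed = cl }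
  where
  cl : Closed A L
  cl {u} {w} u∈ e with w ∈? L
  ... | yes w∈ = w∈
  ... | no w∉ = contradiction (u , w , u∈ , e , w∉) ¬p
grow-reachSet zero L n≤ v∈ U snd | yes (u , w , u∈ , e , w∉) =
  contradiction (≤-trans (Unique⇒length≤ (All.¬Any⇒All¬ _ w∉ ∷ U)) n≤) (<-irrefl refl)
grow-reachSet {n = n} (suc m) L n≤ v∈ U snd | yes (u , w , u∈ , e , w∉) =
  grow-reachSet m (w ∷ L) (subst (n ≤_) (sym (+-suc m (length L))) n≤) (there v∈) (All.¬Any⇒All¬ _ w∉ ∷ U)
    λ { (here refl) → reach-∷ʳ (snd u∈) e ; (there q) → snd q }

reachSet : ∀ (A : Digraph n) v → ReachSet A v
reachSet {n} A v = grow-reachSet n [ v ] (m≤m+n n 1) (here refl) ([] ∷ []) λ { (here refl) → 0 , [] }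

-- If every vertex reachable from `v` leads back to `v`, the reach set is strongly connected.
-- Otherwise some reachable `u` does not lead back, and its reach set is strictly smaller since it
-- misses `v`.
terminal-component : ∀ (A : Digraph n) m v → length (ReachSet.set (reachSet A v)) ≤ m →
  ∃₂ λ L r → r ∈ L × Closed A L × (∀ {u w} → u ∈ L → w ∈ L → Reach A u w)
terminal-component A m v ≤m
  with any? (λ u → ¬? (v ∈? ReachSet.set (reachSet A u))) (ReachSet.set (reachSet A v))
... | no ¬p = set , v , start , closed , λ {u} {w} u∈ w∈ → through u∈ (sound w∈) (v ∈? ReachSet.set (reachSet A u))
  where
  open ReachSet (reachSet A v)
  through : ∀ {u w} → u ∈ set → Reach A v w → Dec (v ∈ ReachSet.set (reachSet A u)) → Reach A u w
  through {u} _ (l , q) (yes v∈) with ReachSet.sound (reachSet A u) v∈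
  ... | k , p = k + l , p ++ʷ q
  through u∈ _ (no v∉) = contradiction (lose u∈ v∉) ¬p
... | yes p with find p
...   | u , u∈ , v∉ = descend m ≤m
  where
  module V = ReachSet (reachSet A v)
  module U = ReachSet (reachSet A u)
  smaller : length U.set < length V.set
  smaller = Unique-⊆⇒length≤ (All.¬Any⇒All¬ _ v∉ ∷ U.uniq)
    λ { (here refl) → V.start ; (there q) → reach-∈ {A = A} V.closed u∈ (proj₂ (U.sound q)) }
  descend : ∀ m → length V.set ≤ m →
    ∃₂ λ L r → r ∈ L × Closed A L × (∀ {u w} → u ∈ L → w ∈ L → Reach A u w)
  descend zero ≤0 = contradiction (≤-trans smaller ≤0) λ ()
  descend (suc m) ≤1+m = terminal-component A m u (s≤s⁻¹ (≤-trans smaller ≤1+m))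

-- Paths and lollipops in a closed, strongly connected set.

module Search {n : ℕ} (A : Digraph n) (δ g : ℕ) (0<δ : 0 < δ)
  (girth : ∀ v ws → IsCycle A v ws → g ≤ length (v ∷ ws))
  (mindeg : MinOutdegGE A δ)
  (K : List (Fin n)) (K-closed : Closed A K) (K-strong : ∀ {u v} → u ∈ K → v ∈ K → Reach A u v) where

  -- The bound 2δ(1 - 1/g) is multiplied through by `g`. At `g` = 0 the subtraction truncates and
  -- both sides are 0.
  Goal : Set
  Goal = Σ (Fin n) (λ v → Σ (List (Fin n)) (λ vs → IsPath A v vs × 2 * δ * (g ∸ 1) ≤ length vs * g))

  -- A path on 2δ vertices has only 2δ - 1 arcs; the hypothesis that it has at least `g` vertices
  -- makes up for the missing one, as 2δ(g - 1) ≤ (ℓ + 1)(g - 1) ≤ ℓg for a path with ℓ arcs and g ≥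
  -- 1.
  long-path : ∀ l → Unique l → Chain A l → δ + δ ≤ length l → g ≤ length l → Goal
  long-path [] _ _ 2δ≤ _ = contradiction (≤-trans 0<δ (≤-trans (m≤m+n δ δ) 2δ≤)) λ ()
  long-path (v ∷ vs) U c 2δ≤ g≤ = v , vs , (U , c) , bound g g≤
    where
    open ≤-Reasoning
    bound : ∀ g → g ≤ suc (length vs) → 2 * δ * (g ∸ 1) ≤ length vs * g
    bound zero _ = ≤-reflexive (trans (*-zeroʳ (2 * δ)) (sym (*-zeroʳ (length vs))))
    bound (suc g) g< = begin
      2 * δ * g             ≡⟨ cong (λ d → (δ + d) * g) (+-identityʳ δ) ⟩
      (δ + δ) * g           ≤⟨ *-monoˡ-≤ g 2δ≤ ⟩
      g + length vs * g     ≤⟨ +-monoˡ-≤ (length vs * g) (s≤s⁻¹ g<) ⟩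
      length vs + length vs * g ≡⟨ *-suc (length vs) g ⟨
      length vs * suc g     ∎

  outdeg-≤ : ∀ {v L} → (∀ {u} → Arc A v u → u ∈ L) → δ ≤ length L
  outdeg-≤ {v} h = ≤-trans (mindeg v)
    (Unique-⊆⇒length≤ (Unique.filter⁺ _ (Unique.allFin⁺ n)) (h ∘ proj₂ ∘ ∈-filterᵇ⁻ (A v) {xs = allFin n}))

  out-arc : ∀ v → ∃ (Arc A v)
  out-arc v with filterᵇ (A v) (allFin n) in eq | mindeg v
  ... | [] | δ≤0 = contradiction (≤-trans 0<δ δ≤0) λ ()
  ... | u ∷ us | _ = u , proj₂ (∈-filterᵇ⁻ (A v) {xs = allFin n} (subst (u ∈_) (sym eq) (here refl)))

  record Path (l : List (Fin n)) : Set where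
    constructor path
    field
      uniq  : Unique l
      chain : Chain A l
      inK   : l ⊆ K

  record Saturated (l : List (Fin n)) : Set where
    constructor saturated
    field
      isPath  : Path l
      {end}   : Fin n
      extends : Extends A l end
      full    : ∀ {u} → Arc A end u → u ∈ l

  path-∷ʳ : ∀ {l z u} → Path l → z ∈ K → Extends A l z → Arc A z u → u ∉ l → Path (l ++ [ u ])
  path-∷ʳ {l} (path U c k) z∈ ext e u∉ = path (Unique-∷ʳ⁺ U u∉) (ext e)
    λ p → [ k , (λ { (here refl) → K-closed z∈ e }) ]′ (∈-++⁻ l p)

  saturate : ∀ m l {z} → n ≤ m + length l → Path l → z ∈ K → Extends A l z → ∃ λ xs → Saturated (l ++ xs)
  saturate m l {z} n≤ P z∈ ext with Fin.any? (λ u → Arc? A z u ×-dec ¬? (u ∈? l))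
  ... | no ¬p = [] , subst Saturated (sym (++-identityʳ l)) (saturated P ext full)
    where
    full : ∀ {u} → Arc A z u → u ∈ l
    full {u} e with u ∈? l
    ... | yes u∈ = u∈
    ... | no u∉ = contradiction (u , e , u∉) ¬p
  saturate zero l n≤ P z∈ ext | yes (u , e , u∉) =
    contradiction (≤-trans (Unique⇒length≤ (All.¬Any⇒All¬ _ u∉ ∷ Path.uniq P)) n≤) (<-irrefl refl)
  saturate (suc m) l n≤ P z∈ ext | yes (u , e , u∉)
    with saturate m (l ++ [ u ])
           (≤-trans n≤ (≤-reflexive (trans (sym (+-suc m (length l))) (cong (m +_) (sym (length-∷ʳ l u))))))
           (path-∷ʳ P z∈ ext e u∉) (K-closed z∈ e) (extends-∷ʳ l (ext e))
  ... | xs , sat = u ∷ xs , subst Saturated (++-assoc l [ u ] xs) sat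

  record Lollipop : Set where
    constructor lollipop
    field
      stem   : List (Fin n)
      {h}    : Fin n
      cs     : List (Fin n)
      isPath : Path (stem ++ h ∷ cs)
      closed : Chain A (h ∷ cs ++ [ h ])
      large  : δ ≤ length (h ∷ cs)
    size : ℕ
    size = length (stem ++ h ∷ cs)
    cycleSize : ℕ
    cycleSize = length (h ∷ cs)

    cycle : IsCycle A h cs
    cycle = proj₁ (proj₂ (Unique-++⁻ stem (Path.uniq isPath))) , closed

  open Lollipop using (size; cycleSize)

  -- The cycle is closed at the earliest out-neighbour `y` of the end vertex. All its out-neighbours
  -- then lie from `y` onwards, which forces at least δ vertices on the cycle.
  curl : ∀ {l} → Saturated l → Σ Lollipop λ L → Lollipop.stem L ++ Lollipop.h L ∷ Lollipop.cs L ≡ l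
  curl {l} (saturated P {z} ext full) with out-arc z
  ... | u , e with first-split (Arc? A z) (lose (full e) e)
  ...   | xs , y , ys , refl , zy , none = lollipop xs ys P closed large , refl
    where
    closed : Chain A (y ∷ ys ++ [ y ])
    closed = proj₂ (chain-split xs (subst (Chain A) (++-assoc xs (y ∷ ys) [ y ]) (ext zy)))
    large : δ ≤ length (y ∷ ys)
    large = outdeg-≤ λ e′ → [ (λ p → contradiction e′ (none p)) , (λ p → p) ]′ (∈-++⁻ xs (full e′))

  curl-path : ∀ {l} → Path l → 0 < length l → Σ Lollipop λ L → length l ≤ size L
  curl-path {l} P 0<l with initLast l
  ... | xs ∷ʳ′ z
    with saturate n (xs ++ [ z ]) (m≤m+n n _) P (Path.inK P (∈-++⁺ʳ xs (here refl))) (extends-∷ʳ xs (Path.chain P))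
  ...   | ys , sat with curl sat
  ...     | L , eq = L , (begin
    length (xs ++ [ z ])                  ≤⟨ m≤m+n _ (length ys) ⟩
    length (xs ++ [ z ]) + length ys      ≡⟨ length-++ (xs ++ [ z ]) ⟨
    length ((xs ++ [ z ]) ++ ys)          ≡⟨ cong length eq ⟨
    size L                                ∎)
    where open ≤-Reasoning

  -- Consequences of a lollipop admitting no improvement.

  Improves : Lollipop → Lollipop → Set
  Improves L L′ = size L < size L′ ⊎ (size L ≡ size L′ × cycleSize L < cycleSize L′)

  -- Maximality is not assumed but encoded by `improve`: wherever a better lollipop would contradict
  -- it, that lollipop is handed over and proves `Goal`.
  module Step (L : Lollipop) (improve : ∀ L′ → Improves L L′ → Goal) where
    open Lollipop L hiding (size; cycleSize) renaming (stem to Q)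
    open Path isPath

    C : List (Fin n)
    C = h ∷ cs

    Q-unique : Unique Q
    Q-unique = proj₁ (Unique-++⁻ Q uniq)

    C-unique : Unique C
    C-unique = proj₁ cycle

    Q#C : Disjoint Q C
    Q#C = proj₂ (proj₂ (Unique-++⁻ Q uniq))

    g≤C : g ≤ length C
    g≤C = girth h cs cycle

    longer : ∀ {l} → Path l → size L < length l → Goal
    longer {l} P s<l with curl-path P (≤-trans (s≤s z≤n) s<l)
    ... | L′ , l≤ = improve L′ (inj₁ (≤-trans s<l l≤))

    module _ {w : Fin n} {ds : List (Fin n)} (w∷ds↭ : w ∷ ds ↭ C) (cd : Chain A (w ∷ ds)) (cQ : Chain A (Q ++ [ w ])) where

      Q++w∷ds↭ : Q ++ w ∷ ds ↭ Q ++ C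
      Q++w∷ds↭ = ++⁺ˡ Q w∷ds↭

      turned : Path (Q ++ w ∷ ds)
      turned = path (Unique-resp-↭ (↭-sym Q++w∷ds↭) uniq) (chain-join Q cQ cd) (inK ∘ ∈-resp-↭ Q++w∷ds↭)

      -- The path `Q ++ w ∷ ds` covers Q ∪ C and ends in `v`. An arc from `v` to a new vertex
      -- lengthens it; an arc back to `u` on Q keeps the size but closes a cycle that contains C and
      -- `u`.
      stays-in-cycle : ∀ {v} → v ∈ C → Extends A (w ∷ ds) v → ∀ u → (Arc A v u → u ∈ C) ⊎ Goal
      stays-in-cycle {v} v∈ ext u with Arc? A v u | u ∈? C | u ∈? Q
      ... | no ¬e | _ | _ = inj₁ λ e → contradiction e ¬e
      ... | yes _ | yes u∈ | _ = inj₁ λ _ → u∈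
      ... | yes e | no u∉C | no u∉Q = inj₂ (longer
            (path-∷ʳ turned (inK (∈-++⁺ʳ Q v∈)) (extends-++ Q cQ ext) e
              λ p → [ u∉Q , u∉C ]′ (∈-++⁻ Q (∈-resp-↭ Q++w∷ds↭ p)))
            (≤-reflexive (trans (cong suc (sym (↭-length Q++w∷ds↭))) (sym (length-∷ʳ (Q ++ w ∷ ds) u)))))
      ... | yes e | no u∉C | yes u∈Q with ∈-∃++ u∈Q
      ...   | Q₁ , Q₂ , eq = inj₂ (improve
              (lollipop Q₁ (Q₂ ++ w ∷ ds) (subst Path eq′ turned)
                (proj₂ (chain-split Q₁ (subst (Chain A)
                  (trans (cong (_++ [ u ]) eq′) (++-assoc Q₁ (u ∷ Q₂ ++ w ∷ ds) [ u ]))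
                  (extends-++ Q cQ ext e))))
                (≤-trans large (<⇒≤ bigger)))
              (inj₂ (trans (sym (↭-length Q++w∷ds↭)) (cong length eq′) , bigger)))
        where
        open ≤-Reasoning
        eq′ : Q ++ w ∷ ds ≡ Q₁ ++ u ∷ Q₂ ++ w ∷ ds
        eq′ = trans (cong (_++ w ∷ ds) eq) (++-assoc Q₁ (u ∷ Q₂) (w ∷ ds))
        bigger : length C < length (u ∷ Q₂ ++ w ∷ ds)
        bigger = s≤s (begin
          length C                      ≡⟨ ↭-length w∷ds↭ ⟨
          length (w ∷ ds)               ≤⟨ m≤n+m _ (length Q₂) ⟩
          length Q₂ + length (w ∷ ds)   ≡⟨ length-++ Q₂ ⟨
          length (Q₂ ++ w ∷ ds)         ∎)

    Good : Fin n → Set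
    Good v = ∀ u → Arc A v u → u ∈ C

    good? : Decidable Good
    good? v = Fin.all? (λ u → Arc? A v u →-dec u ∈? C)

    -- `P` marks vertices at which the stem may enter C. The predecessor on C of each such vertex is
    -- good by `stays-in-cycle`, so the shifted count applies.
    many-good : ∀ {P : Fin n → Set} (P? : Decidable P) → (∀ {w} → P w → Chain A (Q ++ [ w ])) →
      length (filter P? C) ≤ length (filter good? C) ⊎ Goal
    many-good {P} P? entry with count-shift P? good? {Goal} h cs h shift
      where
      shift : ∀ as v w bs → h ∷ cs ++ [ h ] ≡ as ++ v ∷ w ∷ bs → P w → Good v ⊎ Goal
      shift as v w bs eq pw with rotate-after as v w bs closed eq
      ... | ds , ↭C , cd , ext = all-or (stays-in-cycle ↭C cd (entry pw) v∈C ext)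
        where
        v∈C : v ∈ C
        v∈C = [ (λ p → p) , (λ { (here refl) → here refl }) ]′
          (∈-++⁻ C (subst (v ∈_) (sym eq) (∈-++⁺ʳ as (here refl))))
    ... | inj₂ z = inj₂ z
    ... | inj₁ le = inj₁ (≤-trans (≤-reflexive (↭-length (filter-↭ P? (∷↭∷ʳ h cs)))) le)

    module _ {xs : List (Fin n)} {y : Fin n} (sat : Saturated ((Q ++ [ y ]) ++ xs)) (y∉C : y ∉ C) where

      eq₀ : (Q ++ [ y ]) ++ xs ≡ Q ++ y ∷ xs
      eq₀ = ++-assoc Q [ y ] xs

      P₁ : Path (Q ++ y ∷ xs)
      P₁ = subst Path eq₀ (Saturated.isPath sat)

      -- The continuation is followed up to its first vertex `q` on C and then all round C. The part
      -- `F` before `q` is nonempty because `y` is off C, so the result beats Q ∪ C.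
      returning : Any (_∈ C) (y ∷ xs) → Goal
      returning hit with first-split (_∈? C) hit
      ... | [] , q , bs , refl , q∈ , none = contradiction q∈ y∉C
      ... | F@(_ ∷ F′) , q , bs , eq , q∈ , none with rotate-to {A = A} q∈ closed
      ...   | ds , cd , ↭C = longer
        (path (Unique.++⁺ (proj₁ (Unique-++⁻ (Q ++ F) U₁)) (Unique-resp-↭ (↭-sym ↭C) C-unique) dis)
              (chain-join (Q ++ F) (proj₁ (chain-split (Q ++ F) c₁)) (chain-init (q ∷ ds) cd))
              (λ p → [ k₁ ∘ ∈-++⁺ˡ , (λ p′ → inK (∈-++⁺ʳ Q (∈-resp-↭ ↭C p′))) ]′ (∈-++⁻ (Q ++ F) p)))
        (begin
          suc (length (Q ++ C))                    ≡⟨ cong suc (length-++ Q) ⟩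
          suc (length Q + length C)                ≤⟨ s≤s (+-monoˡ-≤ (length C) (m≤m+n (length Q) (length F′))) ⟩
          suc (length Q + length F′ + length C)    ≡⟨ cong (_+ length C) (+-suc (length Q) (length F′)) ⟨
          length Q + length F + length C           ≡⟨ cong₂ _+_ (length-++ Q) (↭-length ↭C) ⟨
          length (Q ++ F) + length (q ∷ ds)        ≡⟨ length-++ (Q ++ F) ⟨
          length ((Q ++ F) ++ q ∷ ds)              ∎)
        where
        open ≤-Reasoning
        P₂ : Path ((Q ++ F) ++ q ∷ bs)
        P₂ = subst Path (trans (cong (Q ++_) eq) (sym (++-assoc Q F (q ∷ bs)))) P₁
        open Path P₂ renaming (uniq to U₁; chain to c₁; inK to k₁)
        dis : Disjoint (Q ++ F) (q ∷ ds)
        dis (r , s) = [ (λ r′ → Q#C (r′ , ∈-resp-↭ ↭C s)) , (λ r′ → none r′ (∈-resp-↭ ↭C s)) ]′ (∈-++⁻ Q r)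

      -- Curling the saturated path gives a cycle inside Q and the continuation, hence disjoint from
      -- C. Strong connectivity of `K` supplies a walk between the two cycles, each of at least δ
      -- vertices.
      leaving : ¬ Any (_∈ C) (y ∷ xs) → Goal
      leaving miss with curl sat
      ... | L′ , eq with K-strong (Path.inK (Lollipop.isPath L′) (∈-++⁺ʳ (Lollipop.stem L′) (here refl)))
                                  (inK (∈-++⁺ʳ Q (here refl)))
      ...   | _ , walk with join-cycles (Lollipop.cycle L′) cycle dis (here refl) (here refl) walk
        where
        dis : Disjoint (Lollipop.h L′ ∷ Lollipop.cs L′) C
        dis (r , s) = [ (λ r′ → Q#C (r′ , s)) , (λ r′ → miss (lose r′ s)) ]′
          (∈-++⁻ Q (subst (_ ∈_) (trans eq eq₀) (∈-++⁺ʳ (Lollipop.stem L′) r)))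
      ...     | l , U , c , len = long-path l U c
                  (≤-trans (+-mono-≤ (Lollipop.large L′) large) len)
                  (≤-trans g≤C (≤-trans (m≤n+m (length C) (cycleSize L′)) len))

    stem-path : Path Q
    stem-path = path Q-unique (chain-init Q chain) (inK ∘ ∈-++⁺ˡ)

    module _ {Q′ : List (Fin n)} {x : Fin n} (eq : Q ≡ Q′ ++ [ x ]) where

      stem-extends : Extends A Q x
      stem-extends = subst (λ l → Extends A l x) (sym eq)
        (extends-∷ʳ Q′ (subst (Chain A) eq (Path.chain stem-path)))

      stem-end-full : ∀ u → (Arc A x u → u ∈ Q ++ C) ⊎ Goal
      stem-end-full u with Arc? A x u | u ∈? (Q ++ C)
      ... | no ¬e | _ = inj₁ λ e → contradiction e ¬e
      ... | yes _ | yes u∈ = inj₁ λ _ → u∈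
      ... | yes e | no u∉
        with saturate n (Q ++ [ u ]) (m≤m+n n _) (path-∷ʳ stem-path x∈K stem-extends e (u∉ ∘ ∈-++⁺ˡ))
               (K-closed x∈K e) (extends-∷ʳ Q (stem-extends e))
        where
        x∈K : x ∈ K
        x∈K = inK (∈-++⁺ˡ (subst (x ∈_) (sym eq) (∈-++⁺ʳ Q′ (here refl))))
      ...   | xs , sat with any? (_∈? C) (u ∷ xs)
      ...     | yes hit = inj₂ (returning sat (u∉ ∘ ∈-++⁺ʳ Q) hit)
      ...     | no miss = inj₂ (leaving sat (u∉ ∘ ∈-++⁺ʳ Q) miss)

    -- When the stem ends in `x`, all out-neighbours of `x` lie in Q ∪ C and at most |Q| of them on
    -- Q; the others are admissible entries to C.
    enough-good : δ ≤ length Q + length (filter good? C) ⊎ Goal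
    enough-good = byEnd (initLast Q) refl
      where
      byEnd : ∀ {R} → InitLast R → Q ≡ R → δ ≤ length Q + length (filter good? C) ⊎ Goal
      byEnd [] eq
        -- With an empty stem every vertex of C may serve as entry, so the predicate is the trivial
        -- one and the count is |C|.
        with many-good (λ _ → yes tt) (λ {w} _ → subst (λ R → Chain A (R ++ [ w ])) (sym eq) tt)
      ... | inj₂ z = inj₂ z
      ... | inj₁ le = inj₁ (begin
        δ                                      ≤⟨ large ⟩
        length C                               ≡⟨ cong length (filter-all (λ _ → yes tt) (All.tabulate {xs = C} (λ _ → tt))) ⟨
        length (filter (λ _ → yes tt) C)       ≤⟨ le ⟩
        length (filter good? C)                ≤⟨ m≤n+m _ (length Q) ⟩
        length Q + length (filter good? C)     ∎)
        where open ≤-Reasoning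
      byEnd (Q′ ∷ʳ′ x) eq with all-or (stem-end-full eq) | many-good (Arc? A x) (stem-extends eq)
      ... | inj₂ z | _ = inj₂ z
      ... | inj₁ _ | inj₂ z = inj₂ z
      ... | inj₁ full | inj₁ le = inj₁ (begin
        δ                                      ≤⟨ outdeg-≤ (λ {u} e → [ ∈-++⁺ˡ , (λ p → ∈-++⁺ʳ Q (∈-filter⁺ (Arc? A x) p e)) ]′ (∈-++⁻ Q (full u e))) ⟩
        length (Q ++ filter (Arc? A x) C)      ≡⟨ length-++ Q ⟩
        length Q + length (filter (Arc? A x) C) ≤⟨ +-monoʳ-≤ (length Q) le ⟩
        length Q + length (filter good? C)     ∎)
        where open ≤-Reasoning

    -- Counting inside the set of good vertices.

    module Finish (enough : δ ≤ length Q + length (filter good? C)) (short : size L < δ + δ) where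
      open ≤-Reasoning

      a c : ℕ
      a = length Q
      c = length C

      size≡ : size L ≡ a + c
      size≡ = length-++ Q

      a<δ : a < δ
      a<δ = +-cancelʳ-< δ a δ (begin-strict
        a + δ   ≤⟨ +-monoʳ-≤ a large ⟩
        a + c   ≡⟨ size≡ ⟨
        size L  <⟨ short ⟩
        δ + δ   ∎)

      -- Surplus good vertices are dropped, so that |S| is exactly δ - |Q|: this gives |S| ≤ δ in
      -- the girth bound and makes the degree estimate come out as `r`.
      S : List (Fin n)
      S = take (δ ∸ a) (filter good? C)

      S-length : length S ≡ δ ∸ a
      S-length = trans (length-take (δ ∸ a) (filter good? C)) (m≤n⇒m⊓n≡m (m≤n+o⇒m∸n≤o δ a enough))

      S-unique : Unique S
      S-unique = Unique.take⁺ (δ ∸ a) (Unique.filter⁺ good? C-unique)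

      S-good : ∀ {v} → v ∈ S → v ∈ C × Good v
      S-good v∈ = ∈-filter⁻ good?
        (subst (_ ∈_) (take++drop≡id (δ ∸ a) (filter good? C)) (∈-++⁺ˡ v∈))

      outside? : Decidable (_∉ S)
      outside? u = ¬? (u ∈? S)

      rest : List (Fin n)
      rest = filter outside? C

      S+rest≤c : length S + length rest ≤ c
      S+rest≤c = begin
        length S + length rest ≡⟨ length-++ S ⟨
        length (S ++ rest)     ≤⟨ Unique-⊆⇒length≤
          (Unique.++⁺ S-unique (Unique.filter⁺ outside? C-unique)
            (λ (p , q) → proj₂ (∈-filter⁻ outside? {xs = C} q) p))
          (λ p → [ proj₁ ∘ S-good , proj₁ ∘ ∈-filter⁻ outside? ]′ (∈-++⁻ S p)) ⟩
        c                      ∎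

      r : ℕ
      r = (δ + δ) ∸ size L

      -- All out-neighbours of a good `v` lie in C and at most |C| - |S| of them outside `S`, which
      -- leaves δ - |C| + (δ - |Q|).
      S-degree : ∀ {v} → v ∈ S → r ≤ length (filterᵇ (A v) S)
      S-degree {v} v∈ = m≤n+o⇒m∸n≤o (δ + δ) (size L) (begin
        δ + δ                                        ≤⟨ +-monoˡ-≤ δ (outdeg-≤ nbrs) ⟩
        length (filterᵇ (A v) S ++ rest) + δ         ≡⟨ cong₂ _+_ (length-++ (filterᵇ (A v) S)) (sym (m∸n+n≡m (<⇒≤ a<δ))) ⟩
        (d + length rest) + ((δ ∸ a) + a)            ≡⟨ cong (λ s → (d + length rest) + (s + a)) S-length ⟨
        (d + length rest) + (length S + a)           ≡⟨ solve 4 (λ d r s a → (d :+ r) :+ (s :+ a) := (a :+ (s :+ r)) :+ d) refl d (length rest) (length S) a ⟩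
        (a + (length S + length rest)) + d           ≤⟨ +-monoˡ-≤ d (+-monoʳ-≤ a S+rest≤c) ⟩
        (a + c) + d                                  ≡⟨ cong (_+ d) size≡ ⟨
        size L + d                                   ∎)
        where
        d : ℕ
        d = length (filterᵇ (A v) S)
        nbrs : ∀ {u} → Arc A v u → u ∈ filterᵇ (A v) S ++ rest
        nbrs {u} e with u ∈? S
        ... | yes u∈ = ∈-++⁺ˡ (∈-filterᵇ⁺ (A v) u∈ e)
        ... | no u∉ = ∈-++⁺ʳ (filterᵇ (A v) S) (∈-filter⁺ outside? (proj₂ (S-good v∈) u e) u∉)

      g-bound : g * suc r ≤ 2 * δ
      g-bound with short-closed-walk (length S) A S r ≤-refl S-unique (m<n⇒0<n∸m short)
                     (subst (0 <_) (sym S-length) (m<n⇒0<n∸m a<δ)) S-degree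
      ... | u , k , walk , le with closed-walk⇒cycle walk
      ...   | v , ws , cyc , ws≤ = begin
        g * suc r       ≤⟨ *-monoˡ-≤ (suc r) (≤-trans (girth v ws cyc) ws≤) ⟩
        suc k * suc r   ≤⟨ le ⟩
        2 * length S    ≤⟨ *-monoʳ-≤ 2 (≤-trans (≤-reflexive S-length) (m∸n≤m δ a)) ⟩
        2 * δ           ∎

      -- The path has ℓ = 2δ - (r + 1) arcs, and `g-bound` says that r + 1 ≤ 2δ/g. Adding 2δ to both
      -- sides keeps truncated subtraction out of the computation.
      length-bound : ∀ g ℓ → r + suc ℓ ≡ δ + δ → g * suc r ≤ 2 * δ → 2 * δ * (g ∸ 1) ≤ ℓ * g
      length-bound zero ℓ _ _ = ≤-reflexive (trans (*-zeroʳ (2 * δ)) (sym (*-zeroʳ ℓ)))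
      length-bound (suc g) ℓ eq le = +-cancelˡ-≤ (2 * δ) _ _ (begin
        2 * δ + 2 * δ * g            ≡⟨ *-suc (2 * δ) g ⟨
        2 * δ * suc g                ≡⟨ cong (λ d → (δ + d) * suc g) (+-identityʳ δ) ⟩
        (δ + δ) * suc g              ≡⟨ cong (_* suc g) eq ⟨
        (r + suc ℓ) * suc g          ≡⟨ solve 3 (λ r l g → (r :+ (con 1 :+ l)) :* g := g :* (con 1 :+ r) :+ l :* g) refl r ℓ (suc g) ⟩
        suc g * suc r + ℓ * suc g    ≤⟨ +-monoˡ-≤ (ℓ * suc g) le ⟩
        2 * δ + ℓ * suc g            ∎)

      goal : Goal
      goal = fromList (Q ++ C) uniq chain refl
        where
        fromList : ∀ l → Unique l → Chain A l → size L ≡ length l → Goal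
        fromList [] _ _ eq = contradiction (trans (sym eq) size≡) λ e → 0≢1+n (trans e (+-suc a (length cs)))
        fromList (v ∷ vs) U ch eq = v , vs , (U , ch) , length-bound g (length vs)
          (trans (cong (r +_) (sym eq)) (m∸n+n≡m (<⇒≤ short))) g-bound

    step : Goal
    step with enough-good | size L <? δ + δ
    ... | inj₂ z | _ = z
    ... | inj₁ enough | yes short = Finish.goal enough short
    ... | inj₁ _ | no ¬short = long-path (Q ++ C) uniq chain (≮⇒≥ ¬short)
      (≤-trans g≤C (≤-trans (m≤n+m _ (length Q)) (≤-reflexive (sym (length-++ Q)))))

  -- Termination of the search.

  size≤n : ∀ L → size L ≤ n
  size≤n L = Unique⇒length≤ (Path.uniq (Lollipop.isPath L))

  cycleSize≤n : ∀ L → cycleSize L ≤ n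
  cycleSize≤n L = Unique⇒length≤ (proj₁ (Lollipop.cycle L))

  -- Lexicographic recursion: `i` bounds the possible growth of the size and `j` that of the cycle.
  -- When the size grows the cycle may shrink, so `j` is reset to `n`.
  search : ∀ i j L → n ≤ i + size L → n ≤ j + cycleSize L → Goal
  search i j L n≤i n≤j = Step.step L (improve i j n≤i n≤j)
    where
    improve : ∀ i j → n ≤ i + size L → n ≤ j + cycleSize L → ∀ L′ → Improves L L′ → Goal
    improve zero j n≤i _ L′ (inj₁ s<) = contradiction (≤-trans s< (≤-trans (size≤n L′) n≤i)) (<-irrefl refl)
    improve (suc i) j n≤i _ L′ (inj₁ s<) = search i n L′
      (≤-trans n≤i (≤-trans (≤-reflexive (sym (+-suc i (size L)))) (+-monoʳ-≤ i s<))) (m≤m+n n _)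
    improve i zero _ n≤j L′ (inj₂ (_ , c<)) = contradiction (≤-trans c< (≤-trans (cycleSize≤n L′) n≤j)) (<-irrefl refl)
    improve i (suc j) n≤i n≤j L′ (inj₂ (s≡ , c<)) = search i j L′ (subst (λ s → n ≤ i + s) s≡ n≤i)
      (≤-trans n≤j (≤-trans (≤-reflexive (sym (+-suc j (cycleSize L)))) (+-monoʳ-≤ j c<)))

  goal : ∀ {r} → r ∈ K → Goal
  -- The search starts from the one-vertex path at `r`, extended until it curls into a lollipop.
  goal {r} r∈ with curl-path {[ r ]} (path ([] ∷ []) tt (λ { (here refl) → r∈ })) (s≤s z≤n)
  ... | L , _ = search n n L (m≤m+n n _) (m≤m+n n _)

theorem1 : (δ : ℕ) → 0 < δ → (n : ℕ) (A : Digraph n) (g : ℕ) →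
    HasGirth A g → MinOutdegGE A δ →
    Σ (Fin n) (λ v → Σ (List (Fin n)) (λ vs →
    IsPath A v vs × 2 * δ * (g ∸ 1) ≤ length vs * g))
theorem1 δ 0<δ n A g ((v , _) , girth) mindeg with terminal-component A _ v ≤-refl
... | K , r , r∈ , closed , strong = Search.goal A δ g 0<δ girth mindeg K closed strong r∈
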